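{- Let $h\colon[n]\to[n]$ be a Hessenberg function and let $w\in\mathfrak S_n$ be a generator for $h$. Then, as sets, $$[w,w_0]_h=[w,w_0],$$ where $[w,w_0]=\{u\in\mathfrak S_n\mid w\preceq u\preceq w_0\}$ is the interval in the Bruhat order and $[w,w_0]_h=\{u\in\mathfrak S_n\mid w\preceq_h u\preceq_h w_0\}$ is the interval in the $h$-Bruhat order.
   Context: A Hessenberg function is a nondecreasing function $h\colon[n]\to[n]$ with $h(i)\ge i$ for all $i$. Permutations $u\in\mathfrak S_n$ are written in one-line notation $u(1)u(2)\cdots u(n)$. For $1\le i<j\le n$, $u(i,j)$ denotes $u$ composed on the right with the transposition $(i,j)$, i.e. the permutation obtained from $u$ by swapping the entries in positions $i$ and $j$. The length $\ell(u)$ is the number of pairs $i<j$ with $u(i)>u(j)$. The Bruhat order $\preceq$ on $\mathfrak S_n$ is the reflexive–transitive closure of the relation $u\prec u(i,j)$ whenever $\ell(u)<\ell(u(i,j))$; $w_0=n(n-1)\cdots1$. The $h$-Bruhat order $\preceq_h$ is the reflexive–transitive closure of the relation $u\prec_h u(i,j)$ whenever $i<j\le h(i)$ and $\ell(u(i,j))>\ell(u)$. A permutation $w\in\mathfrak S_n$ is a generator for $h$ if $w^{ -1}(w(i)+1)\le h(i)$ for every $i$ with $w(i)\le n-1$. -}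

module Defs where

open import Data.Nat as ℕ using (ℕ; suc)
open import Data.Fin as Fin using (Fin; toℕ; opposite)
open import Data.Fin.Properties using (_<?_)
open import Data.Fin.Permutation using (Permutation′; _⟨$⟩ʳ_; _⟨$⟩ˡ_; _≈_; _∘ₚ_; transpose; reverse)
open import Data.List using (List; length; filter; allFin; concatMap; map)
open import Data.Product using (Σ; Σ-syntax; _×_; _,_)
open import Relation.Nullary.Decidable using (_×-dec_)
open import Relation.Binary.PropositionalEquality using (_≡_)

-- Indices/values are 0-based: [n] = {1..n} is modelled by Fin n.
-- A permutation u ∈ S_n is a bijection Fin n ↔ Fin n; u(i) = u ⟨$⟩ʳ i.

record Hessenberg (n : ℕ) : Set where
  field
    fun        : Fin n → Fin n
    monotone   : ∀ {i j} → i Fin.≤ j → fun i Fin.≤ fun j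
    extensive  : ∀ i → i Fin.≤ fun i
open Hessenberg public

pairs : (n : ℕ) → List (Fin n × Fin n)
pairs n = concatMap (λ i → map (λ j → (i , j)) (allFin n)) (allFin n)

len : ∀ {n} → Permutation′ n → ℕ
len {n} u = length (filter (λ { (i , j) → (i <? j) ×-dec ((u ⟨$⟩ʳ j) <? (u ⟨$⟩ʳ i)) }) (pairs n))

-- u(i,j) = u ∘ (i j)  (swap the entries in positions i and j)
_[_,_] : ∀ {n} → Permutation′ n → Fin n → Fin n → Permutation′ n
u [ i , j ] = transpose i j ∘ₚ u

w₀ : ∀ {n} → Permutation′ n
w₀ = reverse

BruhatStep : ∀ {n} → Permutation′ n → Permutation′ n → Set
BruhatStep {n} u v =
  Σ[ i ∈ Fin n ] Σ[ j ∈ Fin n ] (i Fin.< j) × (len u ℕ.< len (u [ i , j ])) × (v ≈ u [ i , j ])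

HBruhatStep : ∀ {n} → Hessenberg n → Permutation′ n → Permutation′ n → Set
HBruhatStep {n} h u v =
  Σ[ i ∈ Fin n ] Σ[ j ∈ Fin n ] (i Fin.< j) × (j Fin.≤ fun h i) ×
    (len u ℕ.< len (u [ i , j ])) × (v ≈ u [ i , j ])

data RTClosure {n : ℕ} (R : Permutation′ n → Permutation′ n → Set)
     : Permutation′ n → Permutation′ n → Set where
  done : ∀ {u v} → u ≈ v → RTClosure R u v
  step : ∀ {u v w} → R u v → RTClosure R v w → RTClosure R u w

_⪯_ : ∀ {n} → Permutation′ n → Permutation′ n → Set
_⪯_ = RTClosure BruhatStep

_⪯[_]_ : ∀ {n} → Permutation′ n → Hessenberg n → Permutation′ n → Set
u ⪯[ h ] v = RTClosure (HBruhatStep h) u v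

-- w is a generator for h: w⁻¹(w(i)+1) ≤ h(i) whenever w(i) ≤ n-1
-- (0-based: whenever w(i)+1 is still in Fin n, i.e. equals some k).
IsGenerator : ∀ {n} → Hessenberg n → Permutation′ n → Set
IsGenerator {n} h w =
  ∀ (i k : Fin n) → toℕ k ≡ suc (toℕ (w ⟨$⟩ʳ i)) → (w ⟨$⟩ˡ k) Fin.≤ fun h i

BruhatInterval : ∀ {n} → Permutation′ n → Permutation′ n → Permutation′ n → Set
BruhatInterval w v u = (w ⪯ u) × (u ⪯ v)

HBruhatInterval : ∀ {n} → Hessenberg n → Permutation′ n → Permutation′ n → Permutation′ n → Set
HBruhatInterval h w v u = (w ⪯[ h ] u) × (u ⪯[ h ] v)

{-# OPTIONS --safe #-}
module Submission where

-- Let r_u(a, q) be the number of positions x < a with u(x) ≥ q. If w ⪯ u then r_w ≤ r_u pointwise.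
-- Conversely, if r_w ≤ r_u, u ≠ w and w is a generator, then u has a descent i < j ≤ h(i) such that
-- r_w ≤ r_{u(i,j)}: let k be the largest value placed differently by w and u, and i = u⁻¹(k). Running
-- through the w-positions of the values below k and using the generator condition at the last one
-- lying weakly left of i gives a position p ≤ h(i) to compare with, and j is the position in (i, p] of
-- the largest entry of u below k. Induction on the length of u yields w ⪯ₕ u.
-- For u ⪯ₕ w₀, every adjacent ascent (i, i+1) of u is allowed by h: if h(i) = i, then the generator w
-- has its largest values at the positions up to i, and so does every u above w.

open import Defs
open import Algebra.Properties.CommutativeSemigroup using (x∙yz≈y∙xz)
open import Data.Fin as Fin using (Fin; zero; suc; toℕ; fromℕ<)
open import Data.Fin.Permutation using (Permutation′; _⟨$⟩ʳ_; _⟨$⟩ˡ_; _≈_; transpose; inverseˡ; inverseʳ)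
open import Data.Fin.Properties as Finₚ using (toℕ<n; toℕ-fromℕ<; fromℕ<-toℕ; toℕ-injective; opposite-prop)
open import Data.List using (List; []; _∷_; _++_; length; lookup; filter; map; concatMap; cartesianProduct; allFin)
open import Data.List.Membership.Propositional using (_∈_)
open import Data.List.Membership.Propositional.Properties using (∈-lookup; ∈-filter⁺; ∈-filter⁻; ∈-allFin; ∈-cartesianProduct⁺)
open import Data.List.Membership.Setoid.Properties using (index-injective)
open import Data.List.Properties using (length-filter)
open import Data.List.Relation.Unary.All as All using ()
open import Data.List.Relation.Unary.AllPairs using (_∷_)
open import Data.List.Relation.Unary.Any using (here; there)
open import Data.List.Relation.Unary.Unique.Propositional using (Unique)
open import Data.List.Relation.Unary.Unique.Propositional.Properties using (allFin⁺; cartesianProduct⁺; filter⁺)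
open import Data.Nat using (ℕ; zero; suc; _+_; _∸_; _≤_; _<_; _≤′_; ≤′-refl; ≤′-step; z≤n; s≤s; s≤s⁻¹)
open import Data.Nat.Induction using (<-wellFounded)
open import Data.Nat.Properties
open import Data.Product as Product using (∃; _×_; _,_; proj₂)
open import Data.Sum using (_⊎_; inj₁; inj₂; [_,_]′)
open import Function using (_∘_; id)
open import Function.Bundles using (_⇔_; mk⇔)
open import Induction.WellFounded using (Acc; acc)
open import Relation.Binary.Definitions using (tri<; tri≈; tri>)
open import Relation.Binary.PropositionalEquality using (_≡_; _≢_; refl; sym; trans; cong; cong₂; subst; subst₂; setoid; ≢-sym)
open import Relation.Nullary using (¬_; yes; no; contradiction)
open import Relation.Nullary.Decidable using (_×-dec_; ¬?; decidable-stable)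
open import Relation.Unary using (Decidable)

-- Length under a swap of two entries

lookup-injective : ∀ {A : Set} {xs : List A} → Unique xs →
  ∀ {i j} → lookup xs i ≡ lookup xs j → i ≡ j
lookup-injective (x∉ ∷ xs!) {zero}  {zero}  eq = refl
lookup-injective (x∉ ∷ xs!) {zero}  {suc j} eq = contradiction eq (All.lookup x∉ (∈-lookup j))
lookup-injective (x∉ ∷ xs!) {suc i} {zero}  eq = contradiction (sym eq) (All.lookup x∉ (∈-lookup i))
lookup-injective (x∉ ∷ xs!) {suc i} {suc j} eq = cong suc (lookup-injective xs! eq)

-- Membership indices turn `φ` into an injection from `Fin (length xs)` to `Fin (length ys)`.
length-injection : ∀ {A B : Set} {xs : List A} {ys : List B} (φ : A → B) → Unique xs →
  (∀ {x} → x ∈ xs → φ x ∈ ys) →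
  (∀ {x y} → x ∈ xs → y ∈ xs → φ x ≡ φ y → x ≡ y) →
  length xs ≤ length ys
length-injection {xs = xs} φ xs! mem inj = Finₚ.injective⇒≤ λ {i} {j} eq →
  lookup-injective xs! (inj (∈-lookup i) (∈-lookup j)
    (index-injective (setoid _) (mem (∈-lookup i)) (mem (∈-lookup j)) eq))

module _ {A : Set} {P Q : A → Set} (P? : Decidable P) (Q? : Decidable Q)
         {xs : List A} (xs! : Unique xs) (∈xs : ∀ x → x ∈ xs) where

  length-filter-≤ : (∀ {x} → P x → Q x) → length (filter P? xs) ≤ length (filter Q? xs)
  length-filter-≤ P⇒Q = length-injection id (filter⁺ P? xs!)
    (∈-filter⁺ Q? (∈xs _) ∘ P⇒Q ∘ proj₂ ∘ ∈-filter⁻ P? {xs = xs}) (λ _ _ eq → eq)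

  -- Put `y` in front of the list for `P`: on this longer list `φ` is its own inverse, hence
  -- injective, and it still lands in the list for `Q`.
  length-filter-< : (φ : A → A) (y : A) → φ y ≡ y → Q y → (∀ {x} → P x → x ≢ y) →
    (∀ {x} → P x → Q (φ x)) → (∀ {x} → P x → φ (φ x) ≡ x) →
    length (filter P? xs) < length (filter Q? xs)
  length-filter-< φ y φy Qy P⇒≢y P⇒Q inv =
    length-injection φ (All.tabulate (λ x∈ → ≢-sym (P⇒≢y (P-of x∈))) ∷ filter⁺ P? xs!) mem
      λ x∈ z∈ eq → trans (sym (inv′ x∈)) (trans (cong φ eq) (inv′ z∈))
    where
    P-of : ∀ {x} → x ∈ filter P? xs → P x
    P-of = proj₂ ∘ ∈-filter⁻ P? {xs = xs}
    mem : ∀ {x} → x ∈ y ∷ filter P? xs → φ x ∈ filter Q? xs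
    mem (here refl) = ∈-filter⁺ Q? (∈xs _) (subst Q (sym φy) Qy)
    mem (there x∈)  = ∈-filter⁺ Q? (∈xs _) (P⇒Q (P-of x∈))
    inv′ : ∀ {x} → x ∈ y ∷ filter P? xs → φ (φ x) ≡ x
    inv′ (here refl) = trans (cong φ φy) φy
    inv′ (there x∈)  = inv (P-of x∈)

concatMap-pair : ∀ {A B : Set} (xs : List A) (ys : List B) →
  concatMap (λ x → map (x ,_) ys) xs ≡ cartesianProduct xs ys
concatMap-pair []       ys = refl
concatMap-pair (x ∷ xs) ys = cong (map (x ,_) ys ++_) (concatMap-pair xs ys)

pairs-unique : ∀ n → Unique (pairs n)
pairs-unique n = subst Unique (sym (concatMap-pair (allFin n) (allFin n)))
  (cartesianProduct⁺ (allFin⁺ n) (allFin⁺ n))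

∈-pairs : ∀ {n} (p : Fin n × Fin n) → p ∈ pairs n
∈-pairs {n} (a , b) = subst (_ ∈_) (sym (concatMap-pair (allFin n) (allFin n)))
  (∈-cartesianProduct⁺ (∈-allFin a) (∈-allFin b))

-- Indexed by the image of `k`, so that matching on a view also replaces the transposed position by
-- its value.
data TransposeView {n} (i j k : Fin n) : Fin n → Set where
  first  : k ≡ i → TransposeView i j k j
  second : k ≡ j → TransposeView i j k i
  other  : k ≢ i → k ≢ j → TransposeView i j k k

transposeView : ∀ {n} (i j k : Fin n) → TransposeView i j k (transpose i j ⟨$⟩ʳ k)
transposeView i j k with k Finₚ.≟ i
... | yes k≡i = first k≡i
... | no  k≢i with k Finₚ.≟ j
...   | yes k≡j = second k≡j
...   | no  k≢j = other k≢i k≢j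

transpose-at₁ : ∀ {n} (i j : Fin n) → transpose i j ⟨$⟩ʳ i ≡ j
transpose-at₁ i j with transpose i j ⟨$⟩ʳ i | transposeView i j i
... | _ | first _     = refl
... | _ | second refl = refl
... | _ | other i≢i _ = contradiction refl i≢i

transpose-at₂ : ∀ {n} (i j : Fin n) → transpose i j ⟨$⟩ʳ j ≡ i
transpose-at₂ i j with transpose i j ⟨$⟩ʳ j | transposeView i j j
... | _ | first refl  = refl
... | _ | second _    = refl
... | _ | other _ j≢j = contradiction refl j≢j

transpose-comm : ∀ {n} (i j k : Fin n) → transpose i j ⟨$⟩ʳ k ≡ transpose j i ⟨$⟩ʳ k
transpose-comm i j k with transpose i j ⟨$⟩ʳ k | transposeView i j k
... | _ | first refl  = sym (transpose-at₂ j i)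
... | _ | second refl = sym (transpose-at₁ j i)
... | _ | other k≢i k≢j with transpose j i ⟨$⟩ʳ k | transposeView j i k
...   | _ | first k≡j  = contradiction k≡j k≢j
...   | _ | second k≡i = contradiction k≡i k≢i
...   | _ | other _ _  = refl

transpose-involutive : ∀ {n} (i j k : Fin n) → transpose i j ⟨$⟩ʳ (transpose i j ⟨$⟩ʳ k) ≡ k
transpose-involutive i j k =
  trans (cong (transpose i j ⟨$⟩ʳ_) (transpose-comm i j k)) (inverseʳ (transpose i j))

swap-involutive : ∀ {n} (u : Permutation′ n) i j → u ≈ (u [ i , j ]) [ i , j ]
swap-involutive u i j k = cong (u ⟨$⟩ʳ_) (sym (transpose-involutive i j k))

swap-at₁ : ∀ {n} (u : Permutation′ n) i j → u [ i , j ] ⟨$⟩ʳ i ≡ u ⟨$⟩ʳ j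
swap-at₁ u i j = cong (u ⟨$⟩ʳ_) (transpose-at₁ i j)

swap-at₂ : ∀ {n} (u : Permutation′ n) i j → u [ i , j ] ⟨$⟩ʳ j ≡ u ⟨$⟩ʳ i
swap-at₂ u i j = cong (u ⟨$⟩ʳ_) (transpose-at₂ i j)

len-≤ : ∀ {n} (u v : Permutation′ n) → u ≈ v → len u ≤ len v
len-≤ {n} u v u≈v = length-filter-≤ _ _ (pairs-unique n) ∈-pairs
  λ (a<b , inv) → a<b , subst₂ Fin._<_ (u≈v _) (u≈v _) inv

len-cong : ∀ {n} (u v : Permutation′ n) → u ≈ v → len u ≡ len v
len-cong u v u≈v = ≤-antisym (len-≤ u v u≈v) (len-≤ v u (sym ∘ u≈v))

-- (a , b) ↦ (t a , t b) for the transposition t, except on the pairs whose order t reverses: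
-- it carries the inversions of u to inversions of u t, and misses (i , j).
module _ {n} (i j : Fin n) where

  private
    t : Fin n → Fin n
    t = transpose i j ⟨$⟩ʳ_

  movePair : Fin n × Fin n → Fin n × Fin n
  movePair (a , b) with t a Finₚ.<? t b
  ... | yes _ = t a , t b
  ... | no  _ = a , b

  movePair-involutive : ∀ {a b} → a Fin.< b → movePair (movePair (a , b)) ≡ (a , b)
  movePair-involutive {a} {b} a<b with t a Finₚ.<? t b
  ... | yes _ with t (t a) Finₚ.<? t (t b)
  ...   | yes _   = cong₂ _,_ (transpose-involutive i j a) (transpose-involutive i j b)
  ...   | no  tta≮ttb = contradiction
    (subst₂ Fin._<_ (sym (transpose-involutive i j a)) (sym (transpose-involutive i j b)) a<b) tta≮ttb
  movePair-involutive {a} {b} a<b | no ta≮tb with t a Finₚ.<? t b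
  ...   | yes ta<tb = contradiction ta<tb ta≮tb
  ...   | no  _     = refl

  movePair-fixed : i Fin.< j → movePair (i , j) ≡ (i , j)
  movePair-fixed i<j with t i Finₚ.<? t j
  ... | no  _     = refl
  ... | yes ti<tj = contradiction
    (subst₂ Fin._<_ (transpose-at₁ i j) (transpose-at₂ i j) ti<tj) (Finₚ.<-asym i<j)

module _ {n} (u : Permutation′ n) {i j : Fin n} (i<j : i Fin.< j) (ui<uj : u ⟨$⟩ʳ i Fin.< u ⟨$⟩ʳ j) where

  private
    v = u [ i , j ]

  Inversion : Permutation′ n → Fin n × Fin n → Set
  Inversion π (a , b) = (a Fin.< b) × (π ⟨$⟩ʳ b Fin.< π ⟨$⟩ʳ a)

  movePair-inversion : ∀ {a b} → Inversion u (a , b) → Inversion v (movePair i j (a , b))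
  movePair-inversion {a} {b} (a<b , ub<ua) with (transpose i j ⟨$⟩ʳ a) Finₚ.<? (transpose i j ⟨$⟩ʳ b)
  ... | yes ta<tb = ta<tb , subst₂ Fin._<_ (swap-involutive u i j b) (swap-involutive u i j a) ub<ua
  -- The transposition reverses this pair, so the pair is kept. It survives as an inversion because
  -- `v` has the larger entry `u(j)` at `i` and the smaller entry `u(i)` at `j`.
  ... | no  ta≮tb with transpose i j ⟨$⟩ʳ a | transposeView i j a | transpose i j ⟨$⟩ʳ b | transposeView i j b
  ...   | _ | first refl  | _ | first refl  = contradiction a<b (Finₚ.<-irrefl refl)
  ...   | _ | first refl  | _ | second refl = a<b , ui<uj
  ...   | _ | first refl  | _ | other _ _   = a<b , Finₚ.<-trans ub<ua ui<uj
  ...   | _ | second refl | _ | first refl  = contradiction a<b (Finₚ.<-asym i<j)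
  ...   | _ | second refl | _ | second refl = contradiction a<b (Finₚ.<-irrefl refl)
  ...   | _ | second refl | _ | other _ _   = contradiction (Finₚ.<-trans i<j a<b) ta≮tb
  ...   | _ | other _ _   | _ | first refl  = contradiction (Finₚ.<-trans a<b i<j) ta≮tb
  ...   | _ | other _ _   | _ | second refl = a<b , Finₚ.<-trans ui<uj ub<ua
  ...   | _ | other _ _   | _ | other _ _   = contradiction a<b ta≮tb

  len-swap-ascent : len u < len v
  len-swap-ascent = length-filter-< _ _ (pairs-unique n) ∈-pairs (movePair i j) (i , j)
    (movePair-fixed i j i<j)
    (i<j , subst₂ Fin._<_ (sym (swap-at₂ u i j)) (sym (swap-at₁ u i j)) ui<uj)
    (λ { (_ , uj<ui) refl → Finₚ.<-asym ui<uj uj<ui })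
    movePair-inversion
    (λ (a<b , _) → movePair-involutive i j a<b)

len-swap-descent : ∀ {n} (u : Permutation′ n) {i j} → i Fin.< j → u ⟨$⟩ʳ j Fin.< u ⟨$⟩ʳ i →
  len (u [ i , j ]) < len u
len-swap-descent u {i} {j} i<j uj<ui =
  subst (len (u [ i , j ]) <_) (sym (len-cong u ((u [ i , j ]) [ i , j ]) (swap-involutive u i j)))
    (len-swap-ascent (u [ i , j ]) i<j
      (subst₂ Fin._<_ (sym (swap-at₁ u i j)) (sym (swap-at₂ u i j)) uj<ui))

perm-injective : ∀ {n} (u : Permutation′ n) {i j} → u ⟨$⟩ʳ i ≡ u ⟨$⟩ʳ j → i ≡ j
perm-injective u eq = trans (sym (inverseˡ u)) (trans (cong (u ⟨$⟩ˡ_) eq) (inverseˡ u))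

-- Turns the length condition of the Bruhat steps into a comparison of two entries: swapping a
-- descent would shorten `u`.
len-swap⇒ascent : ∀ {n} (u : Permutation′ n) {i j} → i Fin.< j → len u < len (u [ i , j ]) →
  u ⟨$⟩ʳ i Fin.< u ⟨$⟩ʳ j
len-swap⇒ascent u {i} {j} i<j lt with Finₚ.<-cmp (u ⟨$⟩ʳ i) (u ⟨$⟩ʳ j)
... | tri< ui<uj _ _ = ui<uj
... | tri≈ _ eq _    = contradiction (perm-injective u eq) (Finₚ.<⇒≢ i<j)
... | tri> _ _ uj<ui = contradiction lt (<-asym (len-swap-descent u i<j uj<ui))

-- Ranks

-- Iverson bracket [ q ≤ v ]
atLeast : ℕ → ℕ → ℕ
atLeast q v with q ≤? v
... | yes _ = 1
... | no  _ = 0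

atLeast-yes : ∀ {q v} → q ≤ v → atLeast q v ≡ 1
atLeast-yes {q} {v} q≤v with q ≤? v
... | yes _  = refl
... | no q≰v = contradiction q≤v q≰v

atLeast-no : ∀ {q v} → v < q → atLeast q v ≡ 0
atLeast-no {q} {v} v<q with q ≤? v
... | yes q≤v = contradiction (<-≤-trans v<q q≤v) (<-irrefl refl)
... | no _    = refl

atLeast-mono : ∀ {q v v′} → (q ≤ v → q ≤ v′) → atLeast q v ≤ atLeast q v′
atLeast-mono {q} {v} imp with q ≤? v
... | yes q≤v = ≤-reflexive (sym (atLeast-yes (imp q≤v)))
... | no _    = z≤n

-- This is r_f(a, q), with `q` as the first argument. Functions on `ℕ` keep the recursion on the
-- prefix free of bounds.
rank : (ℕ → ℕ) → ℕ → ℕ → ℕ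
rank f q zero    = 0
rank f q (suc a) = atLeast q (f a) + rank f q a

-- The rank-matrix criterion for the Bruhat order, larger function first.
Dominates : (ℕ → ℕ) → (ℕ → ℕ) → Set
Dominates g f = ∀ q a → rank f q a ≤ rank g q a

module _ (f g : ℕ → ℕ) (q : ℕ) where

  -- The increments of rank f over [a, b) are at most those of rank g, written without subtraction.
  rank-mono : ∀ {a b} → a ≤′ b → (∀ {x} → a ≤ x → x < b → q ≤ f x → q ≤ g x) →
    rank f q b + rank g q a ≤ rank g q b + rank f q a
  rank-mono {a} ≤′-refl imp = ≤-reflexive (+-comm (rank f q a) (rank g q a))
  rank-mono {a} (≤′-step {b} a≤b) imp = subst₂ _≤_
    (sym (+-assoc (atLeast q (f b)) _ _)) (sym (+-assoc (atLeast q (g b)) _ _))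
    (+-mono-≤ (atLeast-mono (imp (≤′⇒≤ a≤b) (n<1+n b)))
              (rank-mono a≤b λ a≤x x<b → imp a≤x (m≤n⇒m≤1+n x<b)))

  -- Position `c` counts for `g` and not for `f`; this single increment makes the inequality strict.
  rank-mono-< : ∀ {a b c} → a ≤ c → suc c ≤′ b → f c < q → q ≤ g c →
    (∀ {x} → a ≤ x → x < b → q ≤ f x → q ≤ g x) →
    rank f q b + rank g q a < rank g q b + rank f q a
  rank-mono-< {a} {_} {c} a≤c ≤′-refl fc<q q≤gc imp = subst₂ _≤_
    (cong (λ z → suc (z + rank f q c + rank g q a)) (sym (atLeast-no fc<q)))
    (cong (λ z → z + rank g q c + rank f q a) (sym (atLeast-yes q≤gc)))
    (s≤s (rank-mono (≤⇒≤′ a≤c) λ a≤x x<c → imp a≤x (m≤n⇒m≤1+n x<c)))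
  rank-mono-< {a} a≤c (≤′-step {b} c<b) fc<q q≤gc imp = subst₂ _<_
    (sym (+-assoc (atLeast q (f b)) _ _)) (sym (+-assoc (atLeast q (g b)) _ _))
    (+-mono-≤-< (atLeast-mono (imp (≤-trans a≤c (<⇒≤ (≤′⇒≤ c<b))) (n<1+n b)))
              (rank-mono-< a≤c c<b fc<q q≤gc λ a≤x x<b → imp a≤x (m≤n⇒m≤1+n x<b)))

-- A relation rather than an operation, so that it also holds for permutations that equal the
-- swapped one only pointwise.
record IsSwap (f : ℕ → ℕ) (i j : ℕ) (f′ : ℕ → ℕ) : Set where
  field
    at₁  : f′ i ≡ f j
    at₂  : f′ j ≡ f i
    away : ∀ {x} → x ≢ i → x ≢ j → f′ x ≡ f x

module _ {f f′ : ℕ → ℕ} {i j : ℕ} (S : IsSwap f i j f′) (i<j : i < j) (q : ℕ) where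
  open IsSwap S

  rank-swap-before : ∀ {a} → a ≤ i → rank f′ q a ≡ rank f q a
  rank-swap-before {zero}  _   = refl
  rank-swap-before {suc a} a<i = cong₂ _+_
    (cong (atLeast q) (away (<⇒≢ a<i) (<⇒≢ (<-trans a<i i<j)))) (rank-swap-before (<⇒≤ a<i))

  -- A prefix containing `i` but not `j` trades the entry `f i` for `f j`. Each bracket stands on
  -- the side where it is added, which avoids subtraction.
  rank-swap-between : ∀ {a} → i < a → a ≤ j →
    atLeast q (f i) + rank f′ q a ≡ atLeast q (f j) + rank f q a
  rank-swap-between {suc a} i<1+a a<j with m<1+n⇒m<n∨m≡n i<1+a
  ... | inj₂ refl rewrite at₁ | rank-swap-before (≤-refl {i}) =
    x∙yz≈y∙xz +-commutativeSemigroup (atLeast q (f i)) (atLeast q (f j)) (rank f q i)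
  ... | inj₁ i<a rewrite away (≢-sym (<⇒≢ i<a)) (<⇒≢ a<j) =
    trans (x∙yz≈y∙xz +-commutativeSemigroup (atLeast q (f i)) (atLeast q (f a)) _)
      (trans (cong (atLeast q (f a) +_) (rank-swap-between i<a (<⇒≤ a<j)))
        (x∙yz≈y∙xz +-commutativeSemigroup (atLeast q (f a)) (atLeast q (f j)) _))

  rank-swap-after : ∀ {a} → j < a → rank f′ q a ≡ rank f q a
  rank-swap-after {suc a} j<1+a with m<1+n⇒m<n∨m≡n j<1+a
  ... | inj₂ refl rewrite at₂ = rank-swap-between i<j ≤-refl
  ... | inj₁ j<a = cong₂ _+_
    (cong (atLeast q) (away (≢-sym (<⇒≢ (<-trans i<j j<a))) (≢-sym (<⇒≢ j<a)))) (rank-swap-after j<a)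

module _ {f f′ : ℕ → ℕ} {i j : ℕ} (S : IsSwap f i j f′) (i<j : i < j) where

  swap-ascent-dominates : f i < f j → Dominates f′ f
  swap-ascent-dominates fi<fj q a with a ≤? i | a ≤? j
  ... | yes a≤i | _       = ≤-reflexive (sym (rank-swap-before S i<j q a≤i))
  ... | no _    | no a≰j  = ≤-reflexive (sym (rank-swap-after S i<j q (≰⇒> a≰j)))
  ... | no a≰i  | yes a≤j = +-cancelˡ-≤ (atLeast q (f i)) _ _ (≤-trans
    (+-monoˡ-≤ (rank f q a) (atLeast-mono λ q≤fi → ≤-trans q≤fi (<⇒≤ fi<fj)))
    (≤-reflexive (sym (rank-swap-between S i<j q (≰⇒> a≰i) a≤j))))

  -- The swap lowers the rank, and by exactly one, only for `i < a ≤ j` and `f j < q ≤ f i`, so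
  -- strict domination is required there alone.
  swap-descent-dominates : ∀ {w} → f j < f i → Dominates f w →
    (∀ {q a} → i < a → a ≤ j → f j < q → q ≤ f i → rank w q a < rank f q a) → Dominates f′ w
  swap-descent-dominates {w} fj<fi dom strict q a with a ≤? i | a ≤? j
  ... | yes a≤i | _       = subst (rank w q a ≤_) (sym (rank-swap-before S i<j q a≤i)) (dom q a)
  ... | no _    | no a≰j  = subst (rank w q a ≤_) (sym (rank-swap-after S i<j q (≰⇒> a≰j))) (dom q a)
  ... | no a≰i  | yes a≤j with rank-swap-between S i<j q (≰⇒> a≰i) a≤j | q ≤? f j | q ≤? f i
  ...   | eq | yes q≤fj | _ rewrite atLeast-yes q≤fj | atLeast-yes (≤-trans q≤fj (<⇒≤ fj<fi)) =
    subst (rank w q a ≤_) (sym (+-cancelˡ-≡ 1 _ _ eq)) (dom q a)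
  ...   | eq | no q≰fj | no q≰fi rewrite atLeast-no (≰⇒> q≰fj) | atLeast-no (≰⇒> q≰fi) =
    subst (rank w q a ≤_) (sym eq) (dom q a)
  ...   | eq | no q≰fj | yes q≤fi rewrite atLeast-no (≰⇒> q≰fj) | atLeast-yes q≤fi =
    +-cancelˡ-≤ 1 _ _ (subst (rank w q a <_) (sym eq) (strict (≰⇒> a≰i) a≤j (≰⇒> q≰fj) q≤fi))

-- Descents above a generator

module _ {P : ℕ → Set} (P? : Decidable P) where

  greatestBelow : ∀ n → (∃ λ k → k < n × P k × (∀ {v} → k < v → v < n → ¬ P v)) ⊎ (∀ {v} → v < n → ¬ P v)
  greatestBelow zero = inj₂ λ ()
  greatestBelow (suc n) with P? n
  ... | yes Pn = inj₁ (n , n<1+n n , Pn , λ n<v v<1+n _ → <-irrefl refl (<-≤-trans v<1+n n<v))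
  ... | no ¬Pn with greatestBelow n
  ...   | inj₁ (k , k<n , Pk , max) = inj₁ (k , m≤n⇒m≤1+n k<n , Pk , λ k<v v<1+n →
            [ max k<v , (λ { refl → ¬Pn }) ]′ (m<1+n⇒m<n∨m≡n v<1+n))
  ...   | inj₂ none = inj₂ λ v<1+n → [ none , (λ { refl → ¬Pn }) ]′ (m<1+n⇒m<n∨m≡n v<1+n)

  greatestBelow-∃ : ∀ {n x} → x < n → P x → ∃ λ k → k < n × P k × (∀ {v} → k < v → v < n → ¬ P v)
  greatestBelow-∃ {n} x<n Px with greatestBelow n
  ... | inj₁ found = found
  ... | inj₂ none  = contradiction Px (none x<n)

  least : ∀ {x} → P x → ∃ λ m → m ≤ x × P m × (∀ {v} → v < m → ¬ P v)
  least {x} Px with go (suc x)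
    where
    go : ∀ n → (∃ λ m → m < n × P m × (∀ {v} → v < m → ¬ P v)) ⊎ (∀ {v} → v < n → ¬ P v)
    go zero = inj₂ λ ()
    go (suc n) with go n
    ... | inj₁ (m , m<n , rest) = inj₁ (m , m≤n⇒m≤1+n m<n , rest)
    ... | inj₂ none with P? n
    ...   | yes Pn = inj₁ (n , n<1+n n , Pn , none)
    ...   | no ¬Pn = inj₂ λ v<1+n → [ none , (λ { refl → ¬Pn }) ]′ (m<1+n⇒m<n∨m≡n v<1+n)
  ... | inj₁ (m , s≤s m≤x , rest) = m , m≤x , rest
  ... | inj₂ none = contradiction Px (none (n<1+n x))

-- A permutation of [n] continued by the identity to all of `ℕ`; positions and values can then be
-- compared without carrying bounds.
record PermBelow (n : ℕ) : Set where
  field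
    to from : ℕ → ℕ
    to-from : ∀ x → to (from x) ≡ x
    from-to : ∀ x → from (to x) ≡ x
    fixes   : ∀ {x} → n ≤ x → to x ≡ x

  from-fixes : ∀ {x} → n ≤ x → from x ≡ x
  from-fixes n≤x = trans (cong from (sym (fixes n≤x))) (from-to _)

agree-from : ∀ {n} (w f : PermBelow n) → let open PermBelow in ∀ {v} →
  (v < n → ¬ (from w v ≢ from f v)) → from w v ≡ from f v
agree-from {n} w f {v} agree with v <? n
... | yes v<n = decidable-stable (_ ≟ _) (agree v<n)
... | no v≮n  = trans (PermBelow.from-fixes w (≮⇒≥ v≮n)) (sym (PermBelow.from-fixes f (≮⇒≥ v≮n)))

module LargestDifference {n : ℕ} (w f : PermBelow n) (dom : Dominates (PermBelow.to f) (PermBelow.to w))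
  {k : ℕ} (k-differs : PermBelow.from w k ≢ PermBelow.from f k)
  (agree : ∀ {v} → k < v → PermBelow.from w v ≡ PermBelow.from f v) where

  private
    module W = PermBelow w
    module F = PermBelow f

  w-large : ∀ {x} → k < W.to x → F.to x ≡ W.to x
  w-large {x} k<wx = trans (cong F.to (trans (sym (W.from-to x)) (agree k<wx))) (F.to-from _)

  f-large : ∀ {x} → k < F.to x → W.to x ≡ F.to x
  f-large {x} k<fx = trans (cong W.to (trans (sym (F.from-to x)) (sym (agree k<fx)))) (W.to-from _)

  i : ℕ
  i = F.from k

  fi≡k : F.to i ≡ k
  fi≡k = F.to-from k

  f≡k⇒≡i : ∀ {x} → F.to x ≡ k → x ≡ i
  f≡k⇒≡i {x} eq = trans (sym (F.from-to x)) (cong F.from eq)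

  f-small : ∀ {x} → x ≢ i → W.to x ≤ k → F.to x < k
  f-small {x} x≢i wx≤k with <-cmp (F.to x) k
  ... | tri< lt _ _ = lt
  ... | tri≈ _ eq _ = contradiction (f≡k⇒≡i eq) x≢i
  ... | tri> _ _ gt = contradiction (<-≤-trans gt (≤-trans (≤-reflexive (sym (f-large gt))) wx≤k)) (<-irrefl refl)

  wi<k : W.to i < k
  wi<k with <-cmp (W.to i) k
  ... | tri< lt _ _ = lt
  ... | tri≈ _ eq _ = contradiction (trans (cong W.from (sym eq)) (W.from-to i)) k-differs
  ... | tri> _ _ gt = contradiction (trans (sym fi≡k) (w-large gt)) (<⇒≢ gt)

  -- Suppose `f` places `k` further right than `w` does. Up to the place of `k` in `w`, both have
  -- the same entries above `k`, but only `w` has `k`, so its rank at level `k` is larger, against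
  -- domination.
  i<w⁻¹k : i < W.from k
  i<w⁻¹k with <-cmp i (W.from k)
  ... | tri< lt _ _ = lt
  ... | tri≈ _ eq _ = contradiction (sym eq) k-differs
  ... | tri> _ _ gt = contradiction
    (subst₂ _<_ (+-comm _ 0) (+-comm _ 0)
      (rank-mono-< F.to W.to k {a = 0} {c = W.from k} z≤n ≤′-refl
        (f-small (<⇒≢ gt) (≤-reflexive (W.to-from k))) (≤-reflexive (sym (W.to-from k))) imp))
    (≤⇒≯ (dom k (suc (W.from k))))
    where
    f≢k : ∀ {x} → x < suc (W.from k) → F.to x ≢ k
    f≢k x≤ eq = <-irrefl (f≡k⇒≡i eq) (<-≤-trans x≤ gt)
    imp : ∀ {x} → 0 ≤ x → x < suc (W.from k) → k ≤ F.to x → k ≤ W.to x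
    imp _ x≤ k≤fx = subst (k ≤_) (sym (f-large (≤∧≢⇒< k≤fx (≢-sym (f≢k x≤))))) k≤fx

  module _ {m p y : ℕ} (i<p : i < p) (m<wp : m < W.to p) (wp≤k : W.to p ≤ k)
    (before-p : ∀ {x} → x < p → m < W.to x → k < W.to x)
    (y-max : ∀ {v} → y < v → v < k → ¬ (i < F.from v × F.from v ≤ p)) where

    gap : ∀ {x} → i < x → x ≤ p → y < F.to x → k < F.to x
    gap {x} i<x x≤p y<fx with <-cmp (F.to x) k
    ... | tri< lt _ _ = contradiction (subst (λ z → i < z × z ≤ p) (sym (F.from-to x)) (i<x , x≤p))
                          (y-max y<fx lt)
    ... | tri≈ _ eq _ = contradiction (sym (f≡k⇒≡i eq)) (<⇒≢ i<x)
    ... | tri> _ _ gt = gt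

    -- Provides the slack that pays for exchanging the entry `k` at `i` with `y`. For `q` above `m`
    -- the slack is found to the left of `a`, otherwise between `a` and `p`.
    rank-strict : ∀ {q a} → i < a → a ≤ p → y < q → q ≤ k → rank W.to q a < rank F.to q a
    rank-strict {q} {a} i<a a≤p y<q q≤k with m <? q
    -- w takes no value in [q , k] left of p.
    ... | yes m<q = subst₂ _<_ (+-comm _ 0) (+-comm _ 0)
      (rank-mono-< W.to F.to q z≤n (≤⇒≤′ i<a) wi<q (≤-trans q≤k (≤-reflexive (sym fi≡k)))
        λ _ x<a q≤wx → ≤-trans q≤wx (≤-reflexive (sym
          (w-large (before-p (<-≤-trans x<a a≤p) (<-≤-trans m<q q≤wx))))))
      where
      -- The strict position is `i`, where `f` takes `k`, which is at least `q`.
      wi<q : W.to i < q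
      wi<q = ≰⇒> λ q≤wi → <-asym (before-p i<p (<-≤-trans m<q q≤wi)) wi<k
    -- On [a , p] the rank of w grows more than that of f, which still dominates at the end.
    ... | no m≮q = +-cancelˡ-< (rank F.to q (suc p)) _ _ (<-≤-trans
      (rank-mono-< F.to W.to q a≤p ≤′-refl fp<q (≤-trans (≮⇒≥ m≮q) (<⇒≤ m<wp))
        λ a≤x x≤p q≤fx → ≤-trans q≤fx (≤-reflexive (sym (f-large
          (gap (<-≤-trans i<a a≤x) (s≤s⁻¹ x≤p) (<-≤-trans y<q q≤fx))))))
      (+-monoˡ-≤ (rank F.to q a) (dom q (suc p))))
      where
      -- The strict position is `p`: an entry of `f` there above `y` would exceed `k`, yet
      -- `W.to p ≤ k` keeps it below `k`.
      fp<q : F.to p < q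
      fp<q = ≰⇒> λ q≤fp → <-asym (f-small (≢-sym (<⇒≢ i<p)) wp≤k) (gap i<p ≤-refl (<-≤-trans y<q q≤fp))

-- The swapped function is quantified over in `dom`, since no swap is constructed on `ℕ`; the
-- permutation `u [ i , j ]` is supplied later.
record Descent {n : ℕ} (w f : PermBelow n) (h : ℕ → ℕ) : Set where
  open PermBelow f
  field
    {i j} : ℕ
    i<j   : i < j
    j<n   : j < n
    j≤hi  : j ≤ h i
    fj<fi : to j < to i
    dom   : ∀ {f′} → IsSwap to i j f′ → Dominates f′ (PermBelow.to w)

-- m is the largest value below k which w places weakly left of i;
-- p is the leftmost position where w takes a value in (m , k]; y is the largest value below k
-- which f takes on (i , p].
descent-at : ∀ {n} (w f : PermBelow n) (h : ℕ → ℕ) → let open PermBelow in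
  (∀ {x y} → x ≤ y → y < n → h x ≤ h y) →
  (∀ x → suc (to w x) < n → from w (suc (to w x)) ≤ h x) →
  Dominates (to f) (to w) →
  ∀ {k} → k < n → from w k ≢ from f k → (∀ {v} → k < v → from w v ≡ from f v) →
  Descent w f h
descent-at {n} w f h h-mono gen dom {k} k<n k-differs agree =
  -- The value `W.to i` witnesses that candidates for `m` exist.
  search-m (greatestBelow-∃ (λ v → W.from v ≤? i) wi<k (≤-reflexive (W.from-to i)))
  where
  module W = PermBelow w
  module F = PermBelow f
  open LargestDifference w f dom k-differs agree

  i<n : i < n
  i<n = ≰⇒> λ n≤i → <-irrefl (trans (sym fi≡k) (F.fixes n≤i)) (<-≤-trans k<n n≤i)

  search-m : (∃ λ m → m < k × W.from m ≤ i × (∀ {v} → m < v → v < k → ¬ (W.from v ≤ i))) → Descent w f h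
  search-m (m , m<k , w⁻¹m≤i , m-max) =
    -- The value `suc m` lies in (m , k], so its position in `w` is a candidate. Starting there
    -- bounds `p` by the position to which the generator condition applies.
    search-p (least (λ x → (m <? W.to x) ×-dec (W.to x ≤? k)) {W.from (suc m)}
      (subst (λ v → m < v × v ≤ k) (sym (W.to-from (suc m))) (n<1+n m , m<k)))
    where
    right-of-i : ∀ {v} → m < v → v ≤ k → i < W.from v
    right-of-i m<v v≤k with m≤n⇒m<n∨m≡n v≤k
    ... | inj₁ v<k  = ≰⇒> (m-max m<v v<k)
    ... | inj₂ refl = i<w⁻¹k

    search-p : (∃ λ p → p ≤ W.from (suc m) × (m < W.to p × W.to p ≤ k) ×
                 (∀ {x} → x < p → ¬ (m < W.to x × W.to x ≤ k))) → Descent w f h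
    search-p (p , p≤w⁻¹sm , (m<wp , wp≤k) , p-min) =
      -- The entry of `f` at `p` is a candidate for `y`.
      search-y (greatestBelow-∃ (λ v → (i <? F.from v) ×-dec (F.from v ≤? p))
        (f-small (≢-sym (<⇒≢ i<p)) wp≤k)
        (subst (λ x → i < x × x ≤ p) (sym (F.from-to p)) (i<p , ≤-refl)))
      where
      i<p : i < p
      i<p = subst (i <_) (W.from-to p) (right-of-i m<wp wp≤k)

      -- With w⁻¹ for `W.from`: p ≤ w⁻¹(m+1) ≤ h(w⁻¹(m)) ≤ h(i), by the choice of `p`, the generator
      -- condition and monotonicity.
      p≤hi : p ≤ h i
      p≤hi = ≤-trans p≤w⁻¹sm (≤-trans
        (subst (λ v → W.from (suc v) ≤ h (W.from m)) (W.to-from m)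
          (gen (W.from m) (subst (λ v → suc v < n) (sym (W.to-from m)) (≤-<-trans m<k k<n))))
        (h-mono w⁻¹m≤i i<n))

      search-y : (∃ λ y → y < k × (i < F.from y × F.from y ≤ p) ×
                   (∀ {v} → y < v → v < k → ¬ (i < F.from v × F.from v ≤ p))) → Descent w f h
      search-y (y , y<k , (i<j , j≤p) , y-max) = record
        { i<j = i<j ; j<n = j<n ; j≤hi = ≤-trans j≤p p≤hi ; fj<fi = fj<fi
        ; dom = λ S → swap-descent-dominates S i<j fj<fi dom λ i<a a≤j fj<q q≤fi →
            rank-strict i<p m<wp wp≤k (λ x<p m<wx → ≰⇒> λ wx≤k → p-min x<p (m<wx , wx≤k)) y-max
              i<a (≤-trans a≤j j≤p) (subst (_< _) fj≡y fj<q) (subst (_ ≤_) fi≡k q≤fi)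
        }
        where
        fj≡y : F.to (F.from y) ≡ y
        fj≡y = F.to-from y

        fj<fi : F.to (F.from y) < F.to i
        fj<fi = subst₂ _<_ (sym fj≡y) (sym fi≡k) y<k

        j<n : F.from y < n
        j<n = ≰⇒> λ n≤j → <-irrefl (trans (sym fj≡y) (F.fixes n≤j)) (<-≤-trans (<-trans y<k k<n) n≤j)

descent : ∀ {n} (w f : PermBelow n) (h : ℕ → ℕ) → let open PermBelow in
  (∀ {x y} → x ≤ y → y < n → h x ≤ h y) →
  (∀ x → suc (to w x) < n → from w (suc (to w x)) ≤ h x) →
  Dominates (to f) (to w) →
  (∀ x → to w x ≡ to f x) ⊎ Descent w f h
descent {n} w f h h-mono gen dom with greatestBelow (λ v → ¬? (PermBelow.from w v ≟ PermBelow.from f v)) n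
... | inj₁ (k , k<n , k-differs , k-max) =
  inj₂ (descent-at w f h h-mono gen dom k<n k-differs λ k<v → agree-from w f (k-max k<v))
... | inj₂ none = inj₁ λ x →
  trans (sym (F.to-from _)) (cong F.to (trans (sym (agree-from w f none)) (W.from-to x)))
  where
  module W = PermBelow w
  module F = PermBelow f

-- From permutations of Fin n to functions on ℕ

-- The default is the identity so that mutually inverse maps extend to mutually inverse maps.
extend : ∀ {n} → (Fin n → Fin n) → ℕ → ℕ
extend {n} f x with x <? n
... | yes x<n = toℕ (f (fromℕ< x<n))
... | no  _   = x

below : ∀ {n x} → x < n → ∃ λ (i : Fin n) → x ≡ toℕ i
below x<n = fromℕ< x<n , sym (toℕ-fromℕ< x<n)

extend-toℕ : ∀ {n} (f : Fin n → Fin n) i → extend f (toℕ i) ≡ toℕ (f i)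
extend-toℕ {n} f i with toℕ i <? n
... | yes i<n = cong (toℕ ∘ f) (fromℕ<-toℕ i i<n)
... | no  i≮n = contradiction (toℕ<n i) i≮n

extend-fixes : ∀ {n} (f : Fin n → Fin n) {x} → n ≤ x → extend f x ≡ x
extend-fixes {n} f {x} n≤x with x <? n
... | yes x<n = contradiction x<n (≤⇒≯ n≤x)
... | no  _   = refl

extend-cong : ∀ {n} {f g : Fin n → Fin n} → (∀ i → f i ≡ g i) → ∀ x → extend f x ≡ extend g x
extend-cong {n} f≗g x with x <? n
... | yes x<n = cong toℕ (f≗g (fromℕ< x<n))
... | no  _   = refl

extend-inverse : ∀ {n} {f g : Fin n → Fin n} → (∀ i → f (g i) ≡ i) → ∀ x → extend f (extend g x) ≡ x
extend-inverse {n} {f} {g} fg x with x <? n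
... | yes x<n = trans (extend-toℕ f _) (trans (cong toℕ (fg _)) (toℕ-fromℕ< x<n))
... | no  x≮n = extend-fixes f (≮⇒≥ x≮n)

⟦_⟧ : ∀ {n} → Permutation′ n → PermBelow n
⟦ u ⟧ = record
  { to      = extend (u ⟨$⟩ʳ_)
  ; from    = extend (u ⟨$⟩ˡ_)
  ; to-from = extend-inverse λ _ → inverseʳ u
  ; from-to = extend-inverse λ _ → inverseˡ u
  ; fixes   = extend-fixes (u ⟨$⟩ʳ_)
  }

at : ∀ {n} → Permutation′ n → ℕ → ℕ
at u = PermBelow.to ⟦ u ⟧

at-toℕ : ∀ {n} (u : Permutation′ n) i → at u (toℕ i) ≡ toℕ (u ⟨$⟩ʳ i)
at-toℕ u = extend-toℕ (u ⟨$⟩ʳ_)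

swap-isSwap : ∀ {n} (u v : Permutation′ n) i j → v ≈ u [ i , j ] → IsSwap (at u) (toℕ i) (toℕ j) (at v)
swap-isSwap {n} u v i j v≈ = record
  { at₁  = moves (trans (v≈ i) (swap-at₁ u i j))
  ; at₂  = moves (trans (v≈ j) (swap-at₂ u i j))
  ; away = away
  }
  where
  moves : ∀ {a b} → v ⟨$⟩ʳ a ≡ u ⟨$⟩ʳ b → at v (toℕ a) ≡ at u (toℕ b)
  moves eq = trans (at-toℕ v _) (trans (cong toℕ eq) (sym (at-toℕ u _)))

  away : ∀ {x} → x ≢ toℕ i → x ≢ toℕ j → at v x ≡ at u x
  away {x} x≢i x≢j with x <? n
  ... | no _    = refl
  ... | yes x<n = cong toℕ (trans (v≈ k) (cong (u ⟨$⟩ʳ_) fixed))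
    where
    k = fromℕ< x<n
    fixed : transpose i j ⟨$⟩ʳ k ≡ k
    fixed with transpose i j ⟨$⟩ʳ k | transposeView i j k
    ... | _ | first k≡i  = contradiction (trans (sym (toℕ-fromℕ< x<n)) (cong toℕ k≡i)) x≢i
    ... | _ | second k≡j = contradiction (trans (sym (toℕ-fromℕ< x<n)) (cong toℕ k≡j)) x≢j
    ... | _ | other _ _  = refl

rank-cong : ∀ {f g : ℕ → ℕ} → (∀ x → f x ≡ g x) → ∀ q a → rank f q a ≡ rank g q a
rank-cong f≗g q zero    = refl
rank-cong f≗g q (suc a) = cong₂ _+_ (cong (atLeast q) (f≗g a)) (rank-cong f≗g q a)

-- Each step swaps an ascent, which moves a larger entry to the left and cannot lower a rank.
⪯⇒dominates : ∀ {n} {w u : Permutation′ n} → w ⪯ u → Dominates (at u) (at w)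
⪯⇒dominates (done w≈u) q a = ≤-reflexive (rank-cong (extend-cong w≈u) q a)
⪯⇒dominates {w = w} (step {v = v} (i , j , i<j , lt , v≈) v⪯u) q a = ≤-trans
  (swap-ascent-dominates (swap-isSwap w v i j v≈) i<j
    (subst₂ _<_ (sym (at-toℕ w i)) (sym (at-toℕ w j)) (len-swap⇒ascent w i<j lt)) q a)
  (⪯⇒dominates v⪯u q a)

-- Appending steps to chains

module _ {n} {R : Permutation′ n → Permutation′ n → Set}
  (respˡ : ∀ {u u′ v} → u ≈ u′ → R u′ v → R u v) where

  -- A chain ends in a pointwise equality, and `respˡ` carries the new step across it.
  snoc : ∀ {u v w} → RTClosure R u v → R v w → RTClosure R u w
  snoc (done u≈v) r = step (respˡ u≈v r) (done λ _ → refl)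
  snoc (step r c) s = step r (snoc c s)

len-<-respˡ : ∀ {n} (u u′ : Permutation′ n) {i j} → u ≈ u′ →
  len u′ < len (u′ [ i , j ]) → len u < len (u [ i , j ])
len-<-respˡ u u′ {i} {j} u≈u′ =
  subst₂ _<_ (len-cong u′ u (sym ∘ u≈u′)) (len-cong (u′ [ i , j ]) (u [ i , j ]) λ _ → sym (u≈u′ _))

BruhatStep-respˡ : ∀ {n} {u u′ v : Permutation′ n} → u ≈ u′ → BruhatStep u′ v → BruhatStep u v
BruhatStep-respˡ {u = u} {u′} {v} u≈u′ (i , j , i<j , lt , v≈) =
  i , j , i<j , len-<-respˡ u u′ u≈u′ lt , λ k → trans (v≈ k) (sym (u≈u′ _))

HBruhatStep-respˡ : ∀ {n} (h : Hessenberg n) {u u′ v : Permutation′ n} → u ≈ u′ →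
  HBruhatStep h u′ v → HBruhatStep h u v
HBruhatStep-respˡ h {u} {u′} {v} u≈u′ (i , j , i<j , j≤hi , lt , v≈) =
  i , j , i<j , j≤hi , len-<-respˡ u u′ u≈u′ lt , λ k → trans (v≈ k) (sym (u≈u′ _))

⪯ₕ⇒⪯ : ∀ {n} (h : Hessenberg n) {u v : Permutation′ n} → u ⪯[ h ] v → u ⪯ v
⪯ₕ⇒⪯ h (done u≈v)                              = done u≈v
⪯ₕ⇒⪯ h (step (i , j , i<j , _ , lt , v≈) rest) = step (i , j , i<j , lt , v≈) (⪯ₕ⇒⪯ h rest)

-- From rank domination to a chain above the generator

module _ {n} (h : Hessenberg n) where

  bound : ℕ → ℕ
  bound = extend (fun h)

  bound-mono : ∀ {x y} → x ≤ y → y < n → bound x ≤ bound y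
  bound-mono x≤y y<n with below y<n | below (≤-<-trans x≤y y<n)
  ... | j , refl | i , refl = subst₂ _≤_ (sym (extend-toℕ (fun h) i)) (sym (extend-toℕ (fun h) j)) (monotone h x≤y)

module _ {n} (h : Hessenberg n) (w : Permutation′ n) (gen : IsGenerator h w) where

  generator-bound : ∀ x → suc (at w x) < n →
    PermBelow.from ⟦ w ⟧ (suc (at w x)) ≤ bound h x
  generator-bound x sw<n with x <? n
  ... | no x≮n = contradiction (<-trans (n<1+n x) sw<n) x≮n
  ... | yes x<n with below sw<n
  ...   | k , eq rewrite eq = subst (_≤ _) (sym (extend-toℕ (w ⟨$⟩ˡ_) k)) (gen _ k (sym eq))

  -- The chain is built from its top: swapping the descent found gives a shorter `v` that still
  -- dominates `w`, and swapping back is the last step, from `v` to `u`.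
  dominates⇒⪯ₕ : ∀ u → Acc _<_ (len u) → Dominates (at u) (at w) → w ⪯[ h ] u
  dominates⇒⪯ₕ u (acc rec) dom with descent ⟦ w ⟧ ⟦ u ⟧ (bound h) (bound-mono h) generator-bound dom
  ... | inj₁ w≗u = done λ i → toℕ-injective (trans (sym (at-toℕ w i)) (trans (w≗u (toℕ i)) (at-toℕ u i)))
  ... | inj₂ record { i<j = i<j ; j<n = j<n ; j≤hi = j≤hi ; fj<fi = fj<fi ; dom = dom′ }
    with below j<n | below (<-trans i<j j<n)
  ...   | j , refl | i , refl =
    snoc (λ {u} {u′} {v} → HBruhatStep-respˡ h {u} {u′} {v})
      (dominates⇒⪯ₕ v (rec v<u) (dom′ (swap-isSwap u v i j λ _ → refl)))
      (i , j , i<j , subst (_ ≤_) (extend-toℕ (fun h) i) j≤hi ,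
        subst (len v <_) (len-cong u (v [ i , j ]) (swap-involutive u i j)) v<u , swap-involutive u i j)
    where
    v = u [ i , j ]
    v<u : len v < len u
    v<u = len-swap-descent u i<j (subst₂ _<_ (at-toℕ u j) (at-toℕ u i) fj<fi)

  -- If a value sits weakly left of `c`, the generator condition puts the next value at or before
  -- h(c), hence weakly left of `c` again; `d` counts these climbs.
  generator-closed : ∀ {c} → fun h c Fin.≤ c → ∀ {x} → x ≤ toℕ c →
    ∀ d → d + at w x < n → PermBelow.from ⟦ w ⟧ (d + at w x) ≤ toℕ c
  generator-closed hc≤c {x} x≤c zero _ = subst (_≤ _) (sym (PermBelow.from-to ⟦ w ⟧ x)) x≤c
  generator-closed {c} hc≤c {x} x≤c (suc d) lt = ≤-trans
    (subst (λ v → from (suc v) ≤ bound h y) wy≡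
      (generator-bound y (subst (λ v → suc v < n) (sym wy≡) lt)))
    (≤-trans (bound-mono h y≤c (toℕ<n c)) (subst (_≤ toℕ c) (sym (extend-toℕ (fun h) c)) hc≤c))
    where
    open PermBelow ⟦ w ⟧
    y = from (d + at w x)
    y≤c : y ≤ toℕ c
    y≤c = generator-closed hc≤c x≤c d (<-trans (n<1+n _) lt)
    wy≡ : at w y ≡ d + at w x
    wy≡ = to-from (d + at w x)

-- Cuts that no step crosses

SeparatedAt : ∀ {n} → Fin n → Permutation′ n → Set
SeparatedAt c v = ∀ {a b} → a Fin.≤ c → c Fin.< b → v ⟨$⟩ʳ b Fin.< v ⟨$⟩ʳ a

-- Climbing by `d` values from an entry left of the cut to a larger entry at `b` never leaves the
-- left side, so `b` cannot lie to the right.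
generator-separated : ∀ {n} (h : Hessenberg n) (w : Permutation′ n) → IsGenerator h w →
  ∀ {c} → fun h c Fin.≤ c → SeparatedAt c w
generator-separated {n} h w gen {c} hc≤c {a} {b} a≤c c<b = ≰⇒> λ wa≤wb → <⇒≱ c<b (b≤c wa≤wb)
  where
  b≤c : toℕ (w ⟨$⟩ʳ a) ≤ toℕ (w ⟨$⟩ʳ b) → toℕ b ≤ toℕ c
  b≤c wa≤wb = subst (_≤ toℕ c) (trans (cong from reaches) (from-to (toℕ b)))
    (generator-closed h w gen hc≤c a≤c d (subst (_< n) (sym (trans reaches (at-toℕ w b))) (toℕ<n _)))
    where
    open PermBelow ⟦ w ⟧
    d = toℕ (w ⟨$⟩ʳ b) ∸ toℕ (w ⟨$⟩ʳ a)
    reaches : d + at w (toℕ a) ≡ at w (toℕ b)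
    reaches = trans (cong (d +_) (at-toℕ w a)) (trans (m∸n+n≡m wa≤wb) (sym (at-toℕ w b)))

module _ {n} {c i j : Fin n} (i<j : i Fin.< j) (same-side : i Fin.≤ c → ¬ (c Fin.< j)) where

  transpose-≤ : ∀ {a} → a Fin.≤ c → transpose i j ⟨$⟩ʳ a Fin.≤ c
  transpose-≤ {a} a≤c with transpose i j ⟨$⟩ʳ a | transposeView i j a
  ... | _ | first refl  = ≮⇒≥ (same-side a≤c)
  ... | _ | second refl = <⇒≤ (<-≤-trans i<j a≤c)
  ... | _ | other _ _   = a≤c

  transpose-> : ∀ {b} → c Fin.< b → c Fin.< transpose i j ⟨$⟩ʳ b
  transpose-> {b} c<b with transpose i j ⟨$⟩ʳ b | transposeView i j b
  ... | _ | first refl  = <-trans c<b i<j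
  ... | _ | second refl = ≰⇒> λ i≤c → same-side i≤c c<b
  ... | _ | other _ _   = c<b

-- Positions on opposite sides of the cut form a descent, so no step swaps them; a swap within one
-- side leaves the separation intact.
⪯-separated : ∀ {n} {c : Fin n} {w u : Permutation′ n} → w ⪯ u → SeparatedAt c w → SeparatedAt c u
⪯-separated (done w≈u) sep a≤c c<b = subst₂ Fin._<_ (w≈u _) (w≈u _) (sep a≤c c<b)
⪯-separated {c = c} {w} (step {v = v} (i , j , i<j , lt , v≈) v⪯u) sep = ⪯-separated v⪯u λ a≤c c<b →
  subst₂ Fin._<_ (sym (v≈ _)) (sym (v≈ _)) (sep (transpose-≤ i<j same-side a≤c) (transpose-> i<j same-side c<b))
  where
  same-side : i Fin.≤ c → ¬ (c Fin.< j)
  same-side i≤c c<j = <-asym (len-swap⇒ascent w i<j lt) (sep i≤c c<j)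

-- Climbing to the longest permutation

module _ {n} {f : ℕ → ℕ} (f<n : ∀ {x} → x < n → f x < n) (desc : ∀ {x} → suc x < n → f (suc x) < f x) where

  decreasing-upper : ∀ {x} → x < n → f x + x < n
  decreasing-upper {zero}  0<n  = subst (_< n) (sym (+-identityʳ (f 0))) (f<n 0<n)
  decreasing-upper {suc x} sx<n = ≤-<-trans
    (≤-trans (≤-reflexive (+-suc (f (suc x)) x)) (+-monoˡ-≤ x (desc sx<n)))
    (decreasing-upper (<-trans (n<1+n x) sx<n))

  -- Here `d` is the number of positions to the right of `x`, whose values all lie strictly below
  -- `f x`.
  decreasing-lower : ∀ d {x} → d + suc x ≡ n → d ≤ f x
  decreasing-lower zero    _  = z≤n
  decreasing-lower (suc d) {x} eq = ≤-<-trans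
    (decreasing-lower d (trans (+-suc d (suc x)) eq))
    (desc (subst (suc x <_) eq (s≤s (m≤n+m (suc x) d))))

  decreasing-value : ∀ {x} → x < n → f x ≡ n ∸ suc x
  decreasing-value {x} x<n = ≤-antisym
    (m+n≤o⇒m≤o∸n (f x) (subst (_≤ n) (sym (+-suc (f x) x)) (decreasing-upper x<n)))
    (decreasing-lower (n ∸ suc x) (m∸n+n≡m x<n))

at<n : ∀ {n} (u : Permutation′ n) {x} → x < n → at u x < n
at<n {n} u x<n with below x<n
... | i , refl = subst (_< n) (sym (at-toℕ u i)) (toℕ<n _)

no-ascent⇒w₀ : ∀ {n} (u : Permutation′ n) → (∀ {x} → suc x < n → at u (suc x) < at u x) → u ≈ w₀
no-ascent⇒w₀ u desc i = toℕ-injective (trans (sym (at-toℕ u i))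
  (trans (decreasing-value (at<n u) desc (toℕ<n i)) (sym (opposite-prop i))))

at-injective : ∀ {n} (u : Permutation′ n) {x y} → at u x ≡ at u y → x ≡ y
at-injective u {x} {y} eq = trans (sym (from-to x)) (trans (cong from eq) (from-to y))
  where open PermBelow ⟦ u ⟧

len-bounded : ∀ {n} (u : Permutation′ n) → len u ≤ length (pairs n)
len-bounded {n} u = length-filter _ (pairs n)

module _ {n} (h : Hessenberg n) (w : Permutation′ n) (gen : IsGenerator h w) where

  -- Swaps adjacent ascents until none is left. The induction is on the gap between the length and
  -- the number of all pairs; `w ⪯ u` is carried along because it makes each such swap admissible
  -- for `h`.
  ⪯ₕ-w₀ : ∀ u → Acc _<_ (length (pairs n) ∸ len u) → w ⪯ u → u ⪯[ h ] w₀
  ⪯ₕ-w₀ u (acc rec) w⪯u with anyUpTo? (λ x → (suc x <? n) ×-dec (at u x <? at u (suc x))) n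
  ... | no none = done (no-ascent⇒w₀ u λ {x} sx<n → ≤∧≢⇒<
    (≮⇒≥ λ lt → none (x , <-trans (n<1+n x) sx<n , sx<n , lt))
    (λ eq → 1+n≢n (at-injective u eq)))
  ... | yes (x , x<n , sx<n , lt) with below x<n | below sx<n
  ...   | i , refl | j , si≡j = step (i , j , i<j , j≤hi , len< , λ _ → refl)
    (⪯ₕ-w₀ v (rec (∸-monoʳ-< len< (len-bounded v)))
      (snoc (λ {u} {u′} {v} → BruhatStep-respˡ {u = u} {u′} {v}) w⪯u (i , j , i<j , len< , λ _ → refl)))
    where
    v = u [ i , j ]
    i<j : i Fin.< j
    i<j = ≤-reflexive si≡j
    ui<uj : u ⟨$⟩ʳ i Fin.< u ⟨$⟩ʳ j
    ui<uj = subst₂ _<_ (at-toℕ u i) (trans (cong (at u) si≡j) (at-toℕ u j)) lt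
    len< : len u < len v
    len< = len-swap-ascent u i<j ui<uj
    -- As `j` is the successor of `i`, failure means h(i) ≤ i; then `u` inherits from `w` the
    -- separation at `i`, which contradicts the ascent.
    j≤hi : j Fin.≤ fun h i
    j≤hi = ≮⇒≥ λ hi<j → <-asym ui<uj (⪯-separated w⪯u
      (generator-separated h w gen (m<1+n⇒m≤n (subst (_ <_) (sym si≡j) hi<j))) ≤-refl i<j)

theorem3p4 : (n : ℕ) (h : Hessenberg n) (w : Permutation′ n) → IsGenerator h w →
    ∀ (u : Permutation′ n) → HBruhatInterval h w w₀ u ⇔ BruhatInterval w w₀ u
theorem3p4 n h w gen u = mk⇔ (Product.map (⪯ₕ⇒⪯ h) (⪯ₕ⇒⪯ h)) λ (w⪯u , _) →
  dominates⇒⪯ₕ h w gen u (<-wellFounded _) (⪯⇒dominates w⪯u) , ⪯ₕ-w₀ h w gen u (<-wellFounded _) w⪯u
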